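{- Let $r\ge 2$, let $P_1,\dots,P_{3^{r-1}}$ be all the collectable $r$-patterns, and let $a_1,\dots,a_{3^{r-1}}$ be positive integers. If $n\ge\prod_{i=1}^{3^{r-1}}a_i+1$, then (a) every ordered $r$-matching of size $n$ contains a $P_i$-clique of size greater than $a_i2^{ -m(P_i)}$, for some $i\in[3^{r-1}]$; (b) every clean ordered $r$-matching of size $n$ contains a $P_i$-clique of size at least $a_i+1$, for some $i\in[3^{r-1}]$.
   Context: An ordered $r$-matching of size $n$ is a set of $n$ pairwise disjoint $r$-element subsets (edges) of the linearly ordered set $[rn]=\{1,\dots,rn\}$ covering $[rn]$ (more generally, of any finite linearly ordered vertex set; two ordered matchings are identified if they are order-isomorphic). A matching is represented by a word $w_1\cdots w_{rn}$ in which $w_i=w_j$ iff $i,j$ lie in the same edge; words differing by a renaming of letters represent the same matching. An $r$-pattern is an ordered $r$-matching of size two, written as a word in letters $A,B$ each occurring $r$ times (e.g. $AABB$, $ABBA$, $ABAB$ for $r=2$). Two edges $e,f$ of a matching form pattern $P$ if the sub-matching $\{e,f\}$ (with the induced order on $e\cup f$) is order-isomorphic to $P$. A $P$-clique is a matching in which every pair of edges forms $P$; by convention a single edge is a $P$-clique for every $P$. A pattern $P$ is collectable if for every $k\ge2$ there exists a $P$-clique of size $k$. A run is a maximal block of consecutive equal letters in a word; the maturity $m(P)$ of a collectable pattern $P$ is the length of the last maximal run of its word minus $2$, or $0$ if this number is negative. A matching is clean if every pair of its edges forms a collectable pattern. A $P$-clique contained in a matching $M$ means a sub-matching of $M$ (with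 the induced order) which is a $P$-clique. -}

module Defs where

open import Data.Nat using (ℕ; zero; suc; _+_; _*_; _∸_; _^_; _≤_; _<_)
open import Data.Bool using (Bool; true; false; not; if_then_else_)
open import Data.Bool.Properties using () renaming (_≟_ to _≟ᵇ_)
open import Data.Fin using (Fin; zero; suc)
open import Data.Fin.Properties using () renaming (_≟_ to _≟ᶠ_)
open import Data.Vec using (Vec; toList)
import Data.Vec as Vec
open import Data.List using (List; []; _∷_; length; map; filter; reverse)
import Data.List as List
open import Data.List.Relation.Unary.Unique.Propositional using (Unique)
open import Data.List.Membership.Propositional using (_∈_)
open import Data.Product using (Σ; ∃; _×_; _,_)
open import Data.Sum using (_⊎_)
open import Relation.Nullary using (¬_; Dec; yes; no)
open import Relation.Nullary.Decidable using (_⊎-dec_; does)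
open import Relation.Binary.PropositionalEquality using (_≡_)

-- An ordered r-matching of size n, represented by a word of length r*n over
-- the alphabet Fin n (the edges) in which every letter occurs exactly r times.
-- Positions of the word are the vertices 1..rn in their linear order.
record Matching (r n : ℕ) : Set where
  constructor mkMatching
  field
    word    : Vec (Fin n) (r * n)
    regular : ∀ (x : Fin n) → Vec.count (_≟ᶠ x) word ≡ r
open Matching public

-- An r-pattern, written as a word over {A = true, B = false}: length 2r,
-- each letter occurring r times.  We use the canonical representative
-- starting with A (renaming A ↔ B gives the same pattern).
IsPattern : ℕ → List Bool → Set
IsPattern r w = (length w ≡ 2 * r) × (length (filter (_≟ᵇ true) w) ≡ r)
              × ∃ λ t → w ≡ true ∷ t

pairWord : ∀ {r n} → Matching r n → Fin n → Fin n → List Bool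
pairWord M x y =
  map (λ c → does (c ≟ᶠ x))
      (filter (λ c → (c ≟ᶠ x) ⊎-dec (c ≟ᶠ y)) (toList (word M)))

-- Edges x and y form the pattern P: the sub-matching {x,y} is order-isomorphic
-- to P (under one of the two possible letter correspondences).
Forms : ∀ {r n} → Matching r n → Fin n → Fin n → List Bool → Set
Forms M x y P = (pairWord M x y ≡ P) ⊎ (pairWord M x y ≡ map not P)

IsCliqueIn : ∀ {r n} → Matching r n → List Bool → List (Fin n) → Set
IsCliqueIn M P C = Unique C ×
  (∀ x y → x ∈ C → y ∈ C → ¬ x ≡ y → Forms M x y P)

IsClique : ∀ {r n} → Matching r n → List Bool → Set
IsClique {n = n} M P = ∀ (x y : Fin n) → ¬ x ≡ y → Forms M x y P

Collectable : ℕ → List Bool → Set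
Collectable r P = ∀ k → 2 ≤ k → Σ (Matching r k) λ M → IsClique M P

Clean : ∀ {r n} → Matching r n → Set
Clean {r} {n} M = ∀ (x y : Fin n) → ¬ x ≡ y →
  Σ (List Bool) λ P → IsPattern r P × Collectable r P × Forms M x y P

runFrom : Bool → List Bool → ℕ
runFrom b [] = 0
runFrom b (c ∷ cs) = if does (b ≟ᵇ c) then suc (runFrom b cs) else 0

lastRun : List Bool → ℕ
lastRun w with reverse w
... | [] = 0
... | x ∷ xs = suc (runFrom x xs)

maturity : List Bool → ℕ
maturity P = lastRun P ∸ 2

prodFin : ∀ {N} → (Fin N → ℕ) → ℕ
prodFin {zero} f = 1
prodFin {suc N} f = f zero * prodFin (λ i → f (suc i))

{-# OPTIONS --safe #-}

-- Collectable r-patterns are built one vertex pair at a time: either the last block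
-- AᵏBᵏ (or BᵏAᵏ) grows, or a new block AB or BA is appended. By induction on the number
-- of leading vertices considered, a set of edges whose leading vertices form a clique of
-- type c is split into three families. An edge whose next vertex precedes the last
-- vertex of the following edge overlaps it; overlapping is transitive, so Mirsky's theorem
-- produces a chain of overlapping edges and an antichain, and a second application
-- splits the antichain by the order of the new vertices into cliques for the two
-- appended blocks. In an overlapping chain every second edge gives a clique for the
-- grown block; this costs a factor 2 unless k = 1, which is where the maturity comes from.
-- For clean matchings the overlapping chain already is a clique. There one needs that
-- every collectable pattern is one of those constructed, which follows by applying the
-- weighted count to a huge clique of that pattern.
module Submission where

open import Defs
open import Data.Nat hiding (_⊔_)
open import Data.Nat.ListAction using (sum; product)
open import Data.Nat.ListAction.Properties using (product-++; product-↭)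
open import Data.Nat.Properties
open import Data.Nat.Tactic.RingSolver using (solve-∀)
open import Data.Bool using (Bool; true; false; not)
open import Data.Bool.Properties using (not-involutive; not-injective) renaming (_≟_ to _≟ᵇ_)
open import Data.Fin as Fin using (Fin; zero; suc; opposite)
open import Data.Fin.Properties as Fin using (opposite-prop; opposite-involutive; toℕ<n) renaming (_≟_ to _≟ᶠ_)
open import Data.List using (List; []; _∷_; _∷ʳ_; length; map; _++_; filter; replicate; applyUpTo; reverse;
  concatMap; allFin; tabulate)
open import Data.List.Properties
open import Data.List.Membership.Propositional using (_∈_; find)
open import Data.List.Membership.Propositional.Properties using (∈-tabulate⁺; ∈-allFin; ∈-map⁻; ∈-++⁻; ∈-∃++)
open import Data.List.Relation.Binary.Permutation.Propositional using (↭-sym; ↭⇒↭ₛ)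
open import Data.List.Relation.Binary.Permutation.Propositional.Properties using (↭-length; shift; map⁺; ∈-resp-↭)
import Data.List.Relation.Binary.Permutation.Setoid.Properties as Permutation
open import Data.List.Relation.Binary.Subset.Propositional using (_⊆_)
open import Data.List.Relation.Binary.Subset.Propositional.Properties using (⊆-trans; xs⊆x∷xs; ∷⁺ʳ)
open import Data.List.Relation.Unary.All as All using (All; []; _∷_)
import Data.List.Relation.Unary.All.Properties as All
open import Data.List.Relation.Unary.AllPairs as AllPairs using (AllPairs; []; _∷_)
import Data.List.Relation.Unary.AllPairs.Properties as AllPairs
open import Data.List.Relation.Unary.Any using (any?; here; there)
open import Data.List.Relation.Unary.Sorted.TotalOrder.Properties using (Sorted⇒AllPairs)
open import Data.List.Relation.Unary.Unique.Propositional using (Unique)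
import Data.List.Relation.Unary.Unique.Propositional.Properties as Unique
open import Data.List.Sort using (sort; sort-↭; sort-↗)
open import Data.Product using (Σ; ∃; ∃₂; _×_; _,_; proj₁; proj₂)
open import Data.Sum using (_⊎_; inj₁; inj₂; [_,_])
open import Data.Vec as Vec using (Vec; toList; fromList)
open import Data.Vec.Properties using (toList∘fromList)
open import Function using (_∘_; id; _on_; flip)
open import Function.Bundles using (_⇔_; Equivalence)
open import Function.Definitions using (Injective)
open import Level using (0ℓ)
open import Relation.Binary using (Rel; Asymmetric; Decidable; Transitive; DecTotalOrder; tri<; tri≈; tri>)
import Relation.Binary.Construct.On as On
open import Relation.Binary.PropositionalEquality
  using (_≡_; _≢_; refl; sym; trans; cong; cong₂; subst; subst₂; setoid; module ≡-Reasoning)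
open import Relation.Nullary using (¬_; yes; no; contradiction; does)
open import Relation.Nullary.Decidable using (_⊎-dec_; dec-true; dec-false)
open import Relation.Unary using (Pred) renaming (Decidable to Decidable₁)

-- Chains and antichains in lists

-- `S` holds whatever is already known of all pairs, and chains and antichains keep it. Since
-- `AllPairs` relates earlier entries to later ones, `R` is only tested in list order.
module ChainsAndAntichains {E : Set} (S R : Rel E 0ℓ) (R? : Decidable R) (R-trans : Transitive R) where

  Chain Antichain : List E → Set
  Chain     = AllPairs (λ x y → S x y × R x y)
  Antichain = AllPairs (λ x y → S x y × ¬ R x y)

  HeadsChain : List E → ℕ → E → Set
  HeadsChain C h x = ∃ λ D → (x ∷ D) ⊆ C × Chain (x ∷ D) × h ≤ length D

  -- A certificate for Mirsky's theorem: the first list of `Levels C h` is the antichain at height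
  -- `h`, and each of its elements heads a chain with at least `h` further elements.
  data Levels (C : List E) : ℕ → List (List E) → Set where
    []  : ∀ {h} → Levels C h []
    _∷_ : ∀ {h A As} → All (HeadsChain C h) A × Antichain A →
          Levels C (suc h) As → Levels C h (A ∷ As)

  weaken-head : ∀ {C C′ h x} → C ⊆ C′ → HeadsChain C h x → HeadsChain C′ h x
  weaken-head C⊆C′ (D , D⊆C , ch , h≤) = D , ⊆-trans D⊆C C⊆C′ , ch , h≤

  weaken : ∀ {C C′ h As} → C ⊆ C′ → Levels C h As → Levels C′ h As
  weaken C⊆C′ []               = []
  weaken C⊆C′ ((hs , anti) ∷ L) = (All.map (weaken-head C⊆C′) hs , anti) ∷ weaken C⊆C′ L

  -- First fit: x passes a level only if it has an R-successor y there, and then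
  -- x can be put in front of the chain headed by y.
  insert : ∀ {C x h As} → All (S x) C → HeadsChain (x ∷ C) h x → Levels C h As →
           ∃ λ As′ → Levels (x ∷ C) h As′ × sum (map length As′) ≡ suc (sum (map length As)) ×
             (length As′ ≡ length As ⊎ ∃ λ D → Chain D × h + length As′ ≤ length D)
  -- An element that passes every level opens a new one. The chain it brings along has at least
  -- `suc h` elements and so bounds the new number of levels.
  insert {x = x} {h} Sx (D , D⊆ , ch , h≤) [] =
    (x ∷ []) ∷ [] , (((D , D⊆ , ch , h≤) ∷ []) , ([] ∷ [])) ∷ [] , refl ,
    inj₂ (x ∷ D , ch , subst (_≤ suc (length D)) (+-comm 1 h) (s≤s h≤))
  insert {C} {x} {h} {A ∷ As} Sx hx ((hs , anti) ∷ L) with any? (R? x) A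
  ... | no ¬any =
        (x ∷ A) ∷ As ,
        ((hx ∷ All.map (weaken-head (xs⊆x∷xs C x)) hs) ,
         (All.zip (All.anti-mono A⊆C Sx , All.¬Any⇒All¬ A ¬any) ∷ anti)) ∷ weaken (xs⊆x∷xs C x) L ,
        refl , inj₁ refl
    where
    A⊆C : A ⊆ C
    A⊆C y∈A with (_ , D⊆C , _) ← All.lookup hs y∈A = D⊆C (here refl)
  ... | yes any
      with y , y∈A , Rxy ← find any
      with D , D⊆C , yD@(y<D ∷ _) , h≤ ← All.lookup hs y∈A
      with As′ , L′ , size , grown ← insert {h = suc h} Sx
             (y ∷ D , ∷⁺ʳ x D⊆C ,
              (All.zip (All.anti-mono D⊆C Sx , Rxy ∷ All.map (R-trans Rxy ∘ proj₂) y<D) ∷ yD) , s≤s h≤) L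
    = A ∷ As′ , (All.map (weaken-head (xs⊆x∷xs C x)) hs , anti) ∷ L′ ,
      trans (cong (length A +_) size) (+-suc (length A) _) , grown′ grown
    where
    grown′ : length As′ ≡ length As ⊎ (∃ λ D → Chain D × suc h + length As′ ≤ length D) →
             suc (length As′) ≡ suc (length As) ⊎ (∃ λ D → Chain D × h + suc (length As′) ≤ length D)
    grown′ (inj₁ eq)          = inj₁ (cong suc eq)
    grown′ (inj₂ (D , ch , le)) = inj₂ (D , ch , subst (_≤ length D) (sym (+-suc h _)) le)

  levels : ∀ {C} → AllPairs S C →
           ∃₂ λ As D → Levels C 0 As × sum (map length As) ≡ length C × Chain D × length As ≤ length D
  levels [] = [] , [] , [] , refl , [] , z≤n
  levels {x ∷ C} (Sx ∷ SC)
    with As , D , L , size , ch , le ← levels SC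
    with insert Sx ([] , ∷⁺ʳ x (λ ()) , ([] ∷ []) , z≤n) L
  ... | As′ , L′ , size′ , inj₁ eq = As′ , D , L′ , trans size′ (cong suc size) , ch , ≤-trans (≤-reflexive eq) le
  ... | As′ , L′ , size′ , inj₂ (D′ , ch′ , le′) = As′ , D′ , L′ , trans size′ (cong suc size) , ch′ , le′

  largest-level : ∀ {C h As} → Levels C h As →
                  ∃ λ A → Antichain A × sum (map length As) ≤ length As * length A
  largest-level [] = [] , [] , z≤n
  largest-level {As = A ∷ As} ((_ , anti) ∷ L)
    with B , antiB , le ← largest-level L
    with ≤-total (length A) (length B)
  ... | inj₁ A≤B = B , antiB , +-mono-≤ A≤B le
  ... | inj₂ B≤A = A , anti , +-monoʳ-≤ (length A) (≤-trans le (*-monoʳ-≤ (length As) B≤A))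

  -- The levels are at most as many as the entries of `D`, and the largest level has at least
  -- average size.
  mirsky : ∀ {C} → AllPairs S C →
           ∃₂ λ D A → Chain D × Antichain A × length C ≤ length D * length A
  mirsky SC
    with As , D , L , size , ch , As≤D ← levels SC
    with A , anti , le ← largest-level L
    = D , A , ch , anti , ≤-trans (≤-reflexive (sym size)) (≤-trans le (*-monoˡ-≤ (length A) As≤D))

-- Of two consecutive entries `x`, `y` the second is dropped, but it remains the intermediate
-- element that relates `x` to every later `z`.
every-second : ∀ {E : Set} {T U : Rel E 0ℓ} → (∀ {x y z} → T x y → T y z → T x z → U x z) →
               ∀ {D} → AllPairs T D → ∃ λ D′ → D′ ⊆ D × AllPairs U D′ × length D ≤ 2 * length D′
every-second TU [] = [] , id , [] , z≤n
every-second TU {x ∷ []} (_ ∷ []) = x ∷ [] , id , ([] ∷ []) , s≤s z≤n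
every-second TU {x ∷ y ∷ D} ((xy ∷ x<D) ∷ y<D ∷ TD)
  with D′ , D′⊆D , UD′ , le ← every-second TU TD
  = x ∷ D′ , ∷⁺ʳ x (⊆-trans D′⊆D (xs⊆x∷xs D y)) ,
    (All.anti-mono D′⊆D (All.zipWith (λ (yz , xz) → TU xy yz xz) (y<D , x<D)) ∷ UD′) ,
    subst (suc (suc (length D)) ≤_) (sym (*-suc 2 (length D′))) (s≤s (s≤s le))

-- Codes of collectable patterns

-- Code s encodes the collectable (s+1)-patterns, vertex pair by vertex pair:
-- ext turns the last block AᵏBᵏ (or BᵏAᵏ) into Aᵏ⁺¹Bᵏ⁺¹ (Bᵏ⁺¹Aᵏ⁺¹), while
-- new true and new false append the blocks AB and BA.
data Code : ℕ → Set where
  base : Code 0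
  ext  : ∀ {s} → Code s → Code (suc s)
  new  : ∀ {s} → Bool → Code s → Code (suc s)

-- The last block has size suc (span c) and starts after start c vertices of each
-- edge; dir c tells whether it is AᵏBᵏ.
start span : ∀ {s} → Code s → ℕ
start base            = 0
start (ext c)         = start c
start (new {s = s} _ _) = suc s
span base      = 0
span (ext c)   = suc (span c)
span (new _ _) = 0

dir : ∀ {s} → Code s → Bool
dir base      = true
dir (ext c)   = dir c
dir (new d _) = d

start+span : ∀ {s} (c : Code s) → start c + span c ≡ s
start+span base            = refl
start+span (ext c)         = trans (+-suc (start c) (span c)) (cong suc (start+span c))
start+span (new {s} _ _) = +-identityʳ (suc s)

start≤ : ∀ {s} (c : Code s) → start c ≤ s
start≤ c = m+n≤o⇒m≤o (start c) (≤-reflexive (start+span c))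

codes : ∀ s → List (Code s)
codes zero    = base ∷ []
codes (suc s) = map ext (codes s) ++ map (new true) (codes s) ++ map (new false) (codes s)

product-map-* : ∀ {A : Set} (f g : A → ℕ) xs →
                product (map (λ x → f x * g x) xs) ≡ product (map f xs) * product (map g xs)
product-map-* f g []       = refl
product-map-* f g (x ∷ xs) =
  trans (cong (f x * g x *_) (product-map-* f g xs)) (swap (f x) (g x) _ _)
  where
  swap : ∀ a b c d → a * b * (c * d) ≡ a * c * (b * d)
  swap = solve-∀

-- Grouping the three codes that arise from the same `c` turns a family of bounds for `suc s` into
-- one for `s`, which is what the induction in `clique` needs.
product-codes-suc : ∀ s (b : Code (suc s) → ℕ) →
  product (map (λ c → b (ext c) * (b (new true c) * b (new false c))) (codes s)) ≡ product (map b (codes (suc s)))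
product-codes-suc s b
  rewrite map-++ b (map ext (codes s)) (map (new true) (codes s) ++ map (new false) (codes s))
        | map-++ b (map (new true) (codes s)) (map (new false) (codes s))
        | product-++ (map b (map ext (codes s))) (map b (map (new true) (codes s)) ++ map b (map (new false) (codes s)))
        | product-++ (map b (map (new true) (codes s))) (map b (map (new false) (codes s)))
        | sym (map-∘ {g = b} {f = ext} (codes s))
        | sym (map-∘ {g = b} {f = new true} (codes s))
        | sym (map-∘ {g = b} {f = new false} (codes s))
  = trans (product-map-* (b ∘ ext) _ (codes s))
      (cong (product (map (b ∘ ext) (codes s)) *_) (product-map-* (b ∘ new true) (b ∘ new false) (codes s)))

-- An edge is given by the function listing its vertices in increasing order. For `d = false` the
-- two edges exchange roles, so one pair of indices serves both directions.
Before : Bool → ℕ → ℕ → Rel (ℕ → ℕ) 0ℓ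
Before true  i j f g = f i < g j
Before false i j f g = g i < f j

-- The last block has the form AᵏBᵏ when its last A, of index `s`, precedes its first B, of index
-- `start c`.
Block : ∀ {s} → Code s → Rel (ℕ → ℕ) 0ℓ
Block {s} c = Before (dir c) s (start c)

-- Overlap c says that the new vertex of the edge leading in the last block comes too
-- early to start a new block; Gap c is the opposite.
Overlap Gap : ∀ {s} → Code s → Rel (ℕ → ℕ) 0ℓ
Overlap {s} c = Before (dir c) (suc s) s
Gap     {s} c = Before (not (dir c)) s (suc s)

-- Conditions accumulate, so a clique of a code is also one of every code it was built from. The
-- base case fixes `f` as the edge with the smaller first vertex.
Realises : ∀ {s} → Code s → Rel (ℕ → ℕ) 0ℓ
Realises base      f g = Block base f g
Realises (ext c)   f g = Realises c f g × Block (ext c) f g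
Realises (new d c) f g = Realises c f g × Gap c f g × Block (new d c) f g

realises⇒block : ∀ {s} (c : Code s) {f g} → Realises c f g → Block c f g
realises⇒block base      b           = b
realises⇒block (ext c)   (_ , b)     = b
realises⇒block (new d c) (_ , _ , b) = b

realises⇒first< : ∀ {s} (c : Code s) {f g} → Realises c f g → f 0 < g 0
realises⇒first< base      b       = b
realises⇒first< (ext c)   (R , _) = realises⇒first< c R
realises⇒first< (new d c) (R , _) = realises⇒first< c R

Before? : ∀ d i j → Decidable (Before d i j)
Before? true  i j f g = f i <? g j
Before? false i j f g = g i <? f j


gap⇒¬overlap : ∀ {s} (c : Code s) {f g} → Gap c f g → ¬ Overlap c f g
gap⇒¬overlap c G O with dir c
... | true  = <-asym G O
... | false = <-asym G O

Increasing : ℕ → (ℕ → ℕ) → Set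
Increasing r f = ∀ {i j} → i < j → j < r → f i < f j

increasing⇒≤ : ∀ {r f i j} → Increasing r f → i ≤ j → j < r → f i ≤ f j
increasing⇒≤ {f = f} inc i≤j j<r with m≤n⇒m<n∨m≡n i≤j
... | inj₁ i<j  = <⇒≤ (inc i<j j<r)
... | inj₂ refl = ≤-refl

-- As `start c ≤ s`, whatever precedes the first vertex of the last block precedes vertex `s` too.
-- Hence growing a block and appending one exclude each other.
block⇒overlap : ∀ {s r} (c : Code s) {f g} → suc s < r → Increasing r f → Increasing r g →
                     Block (ext c) f g → Overlap c f g
block⇒overlap {s} c s<r incf incg B with dir c
... | true  = <-≤-trans B (increasing⇒≤ incg (start≤ c) (<-trans (n<1+n s) s<r))
... | false = <-≤-trans B (increasing⇒≤ incf (start≤ c) (<-trans (n<1+n s) s<r))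

-- The first growth of a block, from AB to AABB, costs nothing and each later one a factor 2. The
-- exponent is the maturity of the pattern.
weight : ∀ {s} → Code s → ℕ
weight c = 2 ^ (span c ∸ 1)

<-*³ : ∀ {a₁ a₂ a₃ l₁ l₂ l₃} → a₁ * (a₂ * a₃) < l₁ * (l₂ * l₃) → a₁ < l₁ ⊎ a₂ < l₂ ⊎ a₃ < l₃
<-*³ {a₁} {a₂} {a₃} {l₁} {l₂} {l₃} lt with a₁ <? l₁ | a₂ <? l₂ | a₃ <? l₃
... | yes p | _     | _     = inj₁ p
... | no _  | yes p | _     = inj₂ (inj₁ p)
... | no _  | no _  | yes p = inj₂ (inj₂ p)
... | no p  | no q  | no r  = contradiction lt (≤⇒≯ (*-mono-≤ (≮⇒≥ p) (*-mono-≤ (≮⇒≥ q) (≮⇒≥ r))))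

-- Splitting cliques by their next vertex

module Positions {E : Set} (r : ℕ) (pos : E → ℕ → ℕ)
  (increasing : ∀ x → Increasing r (pos x))
  (disjoint : ∀ {x y} → x ≢ y → ∀ {i j} → i < r → j < r → pos x i ≢ pos y j) where

  realises⇒≢ : ∀ {s} (c : Code s) {x y} → Realises c (pos x) (pos y) → x ≢ y
  realises⇒≢ c R refl = <-irrefl refl (realises⇒first< c R)

  -- The two inequalities are linked inside the middle edge, whose vertex `s` precedes its vertex
  -- `suc s`.
  overlap-trans : ∀ {s} (c : Code s) → suc s < r → Transitive (Overlap c on pos)
  overlap-trans {s} c s<r {x} {y} {z} O O′ with dir c
  ... | true  = <-trans O (<-trans (increasing y (n<1+n s) s<r) O′)
  ... | false = <-trans O′ (<-trans (increasing y (n<1+n s) s<r) O)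

  -- Vertex `s` of the middle edge is the link: one overlap places a new vertex before it, and a
  -- block condition places it before the first vertex of the last block of the remaining edge.
  overlap²⇒block : ∀ {s} (c : Code s) {x y z} →
    Realises c (pos x) (pos y) × Overlap c (pos x) (pos y) →
    Realises c (pos y) (pos z) × Overlap c (pos y) (pos z) → Block (ext c) (pos x) (pos z)
  overlap²⇒block c (R , O) (R′ , O′) with dir c | realises⇒block c R | realises⇒block c R′
  ... | true  | _ | B′ = <-trans O B′
  ... | false | B | _  = <-trans O′ B

  ¬overlap⇒gap : ∀ {s} (c : Code s) → suc s < r → ∀ {x y} → x ≢ y →
                 ¬ Overlap c (pos x) (pos y) → Gap c (pos x) (pos y)
  ¬overlap⇒gap {s} c s<r x≢y ¬O with dir c
  ... | true  = ≤∧≢⇒< (≮⇒≥ ¬O) (disjoint (x≢y ∘ sym) (<-trans (n<1+n s) s<r) s<r)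
  ... | false = ≤∧≢⇒< (≮⇒≥ ¬O) (disjoint x≢y (<-trans (n<1+n s) s<r) s<r)

  CliqueOf : ∀ {s} → Code s → List E → Set
  CliqueOf c = AllPairs (Realises c on pos)

  OverlappingChain : ∀ {s} → Code s → List E → Set
  OverlappingChain c = AllPairs (λ x y → Realises c (pos x) (pos y) × Overlap c (pos x) (pos y))

  split-clique : ∀ {s} (c : Code s) → suc s < r → ∀ {C} → CliqueOf c C →
    ∃ λ D₁ → ∃₂ λ D₂ D₃ → OverlappingChain c D₁ × CliqueOf (new true c) D₂ × CliqueOf (new false c) D₃ ×
      length C ≤ length D₁ * (length D₂ * length D₃)
  split-clique {s} c s<r RC
    with D₁ , A , ch₁ , anti , le ← ChainsAndAntichains.mirsky (Realises c on pos) (Overlap c on pos)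
           (λ x y → Before? (dir c) (suc s) s (pos x) (pos y)) (overlap-trans c s<r) RC
    -- In `A` every pair has a gap, so only the order of the new vertices is open: chains receive
    -- the block AB, antichains the block BA.
    with D₂ , D₃ , ch₂ , ch₃ , le′ ← ChainsAndAntichains.mirsky
           (λ x y → Realises c (pos x) (pos y) × Gap c (pos x) (pos y))
           (λ x y → pos x (suc s) < pos y (suc s)) (λ _ _ → _ <? _) <-trans
           (AllPairs.map (λ (R , ¬O) → R , ¬overlap⇒gap c s<r (realises⇒≢ c R) ¬O) anti)
    = D₁ , D₂ , D₃ , ch₁ , AllPairs.map (λ ((R , G) , lt) → R , G , lt) ch₂ ,
      AllPairs.map (λ ((R , G) , ¬lt) → R , G , ≤∧≢⇒< (≮⇒≥ ¬lt) (disjoint (realises⇒≢ c R ∘ sym) s<r s<r)) ch₃ ,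
      ≤-trans le (*-monoʳ-≤ (length D₁) le′)

  -- Both parts of the theorem run the same induction, with `w` equal to `weight` for arbitrary
  -- matchings and constantly 1 for clean ones. They differ in how `extend` is obtained.
  module _ (w : ∀ {s} → Code s → ℕ) (1≤w-base : 1 ≤ w base) (1≤w-new : ∀ {s} d (c : Code s) → 1 ≤ w (new d c))
    (extend : ∀ {s} (c : Code s) → suc s < r → ∀ {D} → OverlappingChain c D →
              ∃ λ D′ → CliqueOf (ext c) D′ × length D * w c ≤ length D′ * w (ext c)) where

    clique : ∀ s → s < r → ∀ {C} → CliqueOf base C → ∀ (b : Code s → ℕ) →
             product (map b (codes s)) < length C →
             ∃₂ λ c D → CliqueOf c D × b c < length D * w c
    clique zero    s<r {C} BC b lt = base , C , BC , (begin-strict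
      b base             ≡⟨ *-identityʳ (b base) ⟨
      b base * 1         <⟨ lt ⟩
      length C           ≤⟨ m≤m*n (length C) _ {{>-nonZero 1≤w-base}} ⟩
      length C * w base  ∎)
      where open ≤-Reasoning
    clique (suc s) s<r BC b lt
      with c , C , RC , lt′ ← clique s (<-trans (n<1+n s) s<r) BC _
             (subst (_< _) (sym (product-codes-suc s b)) lt)
      with D₁ , D₂ , D₃ , ch₁ , ch₂ , ch₃ , le ← split-clique c s<r RC
      -- The whole factor `w c` is charged to the overlapping chain, the only family still to be
      -- turned into a clique. The other two are cliques already, and their new codes have weight at
      -- least 1.
      with <-*³ {b (ext c)} {b (new true c)} {b (new false c)} {length D₁ * w c} {length D₂} {length D₃}
             (<-≤-trans lt′ (≤-trans (*-monoˡ-≤ (w c) le)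
               (≤-reflexive (regroup (length D₁) (length D₂ * length D₃) (w c)))))
      where
      regroup : ∀ l m n → l * m * n ≡ l * n * m
      regroup = solve-∀
    ... | inj₂ (inj₁ lt₂) = new true c , D₂ , ch₂ , <-≤-trans lt₂ (m≤m*n (length D₂) _ {{>-nonZero (1≤w-new true c)}})
    ... | inj₂ (inj₂ lt₃) = new false c , D₃ , ch₃ , <-≤-trans lt₃ (m≤m*n (length D₃) _ {{>-nonZero (1≤w-new false c)}})
    ... | inj₁ lt₁
      with D′ , ch′ , le′ ← extend c s<r ch₁
      = ext c , D′ , ch′ , <-≤-trans lt₁ le′

  extend-weighted : ∀ {s} (c : Code s) → suc s < r → ∀ {D} → OverlappingChain c D →
                    ∃ λ D′ → CliqueOf (ext c) D′ × length D * weight c ≤ length D′ * weight (ext c)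
  extend-weighted {s} c s<r {D} ch with span c in eq
  -- Here `start c` equals `s`, so an overlap is literally the block condition for `ext c` and no
  -- edge is lost.
  ... | zero  = D , AllPairs.map (λ {x} {y} (R , O) → R ,
                  subst (λ i → Before (dir c) (suc s) i (pos x) (pos y)) (sym start≡s) O) ch , ≤-refl
    where
    start≡s : start c ≡ s
    start≡s = trans (sym (+-identityʳ (start c))) (trans (cong (start c +_) (sym eq)) (start+span c))
  -- The length at most halves, rounded up, while the weight doubles from `2 ^ k` to `2 ^ suc k`.
  ... | suc k
      with D′ , _ , ch′ , le ← every-second
             {U = λ x y → Realises c (pos x) (pos y) × Block (ext c) (pos x) (pos y)}
             (λ T T′ (R , _) → R , overlap²⇒block c T T′) ch
      = D′ , ch′ , ≤-trans (*-monoˡ-≤ (2 ^ k) le) (≤-reflexive (regroup (length D′) (2 ^ k)))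
    where
    regroup : ∀ m n → 2 * m * n ≡ m * (2 * n)
    regroup = solve-∀

-- Uniqueness of codes

realises-unique : ∀ {s r} (c d : Code s) {f g} → s < r → Increasing r f → Increasing r g →
                  Realises c f g → Realises d f g → c ≡ d
realises-unique base base _ _ _ _ _ = refl
realises-unique {suc s} (ext c) (ext d) s<r incf incg (R , _) (R′ , _) =
  cong ext (realises-unique c d (<-trans (n<1+n s) s<r) incf incg R R′)
-- A grown block forces an overlap, an appended block a gap.
realises-unique {suc s} (ext c) (new b d) s<r incf incg (R , B) (R′ , G , _)
  with refl ← realises-unique c d (<-trans (n<1+n s) s<r) incf incg R R′
  = contradiction (block⇒overlap c s<r incf incg B) (gap⇒¬overlap c G)
realises-unique {suc s} (new b c) (ext d) s<r incf incg (R , G , _) (R′ , B)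
  with refl ← realises-unique c d (<-trans (n<1+n s) s<r) incf incg R R′
  = contradiction (block⇒overlap c s<r incf incg B) (gap⇒¬overlap c G)
realises-unique {suc s} (new b c) (new b′ d) s<r incf incg (R , _ , B) (R′ , _ , B′)
  with refl ← realises-unique c d (<-trans (n<1+n s) s<r) incf incg R R′
  with b | b′
... | true  | true  = refl
... | true  | false = contradiction B (<-asym B′)
... | false | true  = contradiction B (<-asym B′)
... | false | false = refl

Coded : ℕ → Rel (ℕ → ℕ) 0ℓ
Coded s f g = ∃ λ (c : Code s) → Realises c f g ⊎ Realises c g f

coded-pred : ∀ {s f g} → Coded (suc s) f g → Coded s f g
coded-pred (ext c   , inj₁ (R , _)) = c , inj₁ R
coded-pred (ext c   , inj₂ (R , _)) = c , inj₂ R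
coded-pred (new _ c , inj₁ (R , _)) = c , inj₁ R
coded-pred (new _ c , inj₂ (R , _)) = c , inj₂ R

coded-≤ : ∀ {s t f g} → s ≤′ t → Coded t f g → Coded s f g
coded-≤ ≤′-refl        t = t
coded-≤ (≤′-step s≤t) t = coded-≤ s≤t (coded-pred t)

-- This is how clean matchings avoid the factor 2. By uniqueness the code of the pair must continue
-- `c`; the overlap rules out an appended block, and the first vertices rule out the other order of
-- the edges.
overlap∧coded⇒block : ∀ {s r} (c : Code s) {f g} → suc s < r → Increasing r f → Increasing r g →
  Realises c f g → Overlap c f g → Coded (suc s) f g → Block (ext c) f g
overlap∧coded⇒block c s<r incf incg R O (d , inj₂ R′) =
  contradiction (realises⇒first< c R) (<-asym (realises⇒first< d R′))
overlap∧coded⇒block {s} c s<r incf incg R O (ext d , inj₁ (R′ , B))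
  with refl ← realises-unique c d (<-trans (n<1+n s) s<r) incf incg R R′ = B
overlap∧coded⇒block {s} c s<r incf incg R O (new _ d , inj₁ (R′ , G , _))
  with refl ← realises-unique c d (<-trans (n<1+n s) s<r) incf incg R R′
  = contradiction O (gap⇒¬overlap c G)

-- Words of pairs of edges

-- Merged X Y w: w records, in increasing order, which of X (true) and Y (false)
-- each number of the two lists comes from.
data Merged : List ℕ → List ℕ → List Bool → Set where
  []    : Merged [] [] []
  left  : ∀ {a X Y w} → All (a <_) Y → Merged X Y w → Merged (a ∷ X) Y (true ∷ w)
  right : ∀ {b X Y w} → All (b <_) X → Merged X Y w → Merged X (b ∷ Y) (false ∷ w)

merged-unique : ∀ {X Y v w} → Merged X Y v → Merged X Y w → v ≡ w
merged-unique []        []          = refl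
merged-unique (left _ m) (left _ m′) = cong (true ∷_) (merged-unique m m′)
merged-unique (left (a<b ∷ _) _) (right (b<a ∷ _) _) = contradiction a<b (<-asym b<a)
merged-unique (right (b<a ∷ _) _) (left (a<b ∷ _) _) = contradiction a<b (<-asym b<a)
merged-unique (right _ m) (right _ m′) = cong (false ∷_) (merged-unique m m′)

merged-swap : ∀ {X Y w} → Merged X Y w → Merged Y X (map not w)
merged-swap []         = []
merged-swap (left p m) = right p (merged-swap m)
merged-swap (right p m) = left p (merged-swap m)

map-not-involutive : ∀ w → map not (map not w) ≡ w
map-not-involutive []      = refl
map-not-involutive (b ∷ w) = cong₂ _∷_ (not-involutive b) (map-not-involutive w)

merged-++ : ∀ {X Y w X′ Y′ w′} → Merged X Y w → Merged X′ Y′ w′ →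
            All (λ a → All (a <_) Y′) X → All (λ b → All (b <_) X′) Y →
            Merged (X ++ X′) (Y ++ Y′) (w ++ w′)
merged-++ []          m′ _        _        = m′
merged-++ (left p m)  m′ (q ∷ qs) rs       = left (All.++⁺ p q) (merged-++ m m′ qs rs)
merged-++ (right p m) m′ qs       (r ∷ rs) = right (All.++⁺ p r) (merged-++ m m′ qs rs)

merged-separated : ∀ {X Y} → All (λ a → All (a <_) Y) X →
                   Merged X Y (replicate (length X) true ++ replicate (length Y) false)
merged-separated (p ∷ ps)        = left p (merged-separated ps)
merged-separated {Y = []}    [] = []
merged-separated {Y = _ ∷ Y} [] = right [] (merged-separated [])

merged-length : ∀ {X Y w} → Merged X Y w →
                length w ≡ length X + length Y × length (filter (_≟ᵇ true) w) ≡ length X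
merged-length [] = refl , refl
merged-length (left _ m) with p , q ← merged-length m = cong suc p , cong suc q
merged-length {X} {_ ∷ Y} (right _ m) with p , q ← merged-length m =
  trans (cong suc p) (sym (+-suc (length X) (length Y))) , q

-- The value 0 past the end is a filler; the facts below concern indices within the length.
nth : List ℕ → ℕ → ℕ
nth []      _       = 0
nth (a ∷ X) zero    = a
nth (a ∷ X) (suc i) = nth X i

applyUpTo-nth : ∀ X → applyUpTo (nth X) (length X) ≡ X
applyUpTo-nth []      = refl
applyUpTo-nth (a ∷ X) = cong (a ∷_) (applyUpTo-nth X)

all-nth : ∀ {P : ℕ → Set} {X} → All P X → ∀ {i} → i < length X → P (nth X i)
all-nth (p ∷ ps) {zero}  _       = p
all-nth (p ∷ ps) {suc i} (s≤s lt) = all-nth ps lt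

increasing-nth : ∀ {X} → AllPairs _<_ X → Increasing (length X) (nth X)
increasing-nth (p ∷ ps) {zero}  {suc j} _         (s≤s j<) = all-nth p j<
increasing-nth (p ∷ ps) {suc i} {suc j} (s≤s i<j) (s≤s j<) = increasing-nth ps i<j j<

merged-disjoint : ∀ {X Y w} → Merged X Y w → ∀ {i j} → i < length X → j < length Y → nth X i ≢ nth Y j
merged-disjoint (left p m)  {zero}  i< j<       = <⇒≢ (all-nth p j<)
merged-disjoint (left p m)  {suc i} (s≤s i<) j< = merged-disjoint m i< j<
merged-disjoint (right p m) {j = zero}  i< j<       = <⇒≢ (all-nth p i<) ∘ sym
merged-disjoint (right p m) {j = suc j} i< (s≤s j<) = merged-disjoint m i< j<

-- The word alone fixes all comparisons between the two lists: both mergings consume the same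
-- letters, and an entry consumed first is smaller than everything left in the other list.
merged-determines-< : ∀ {X Y X′ Y′ w} → Merged X Y w → Merged X′ Y′ w → ∀ {i j} →
  i < length X → j < length Y → i < length X′ → j < length Y′ → nth X i < nth Y j → nth X′ i < nth Y′ j
merged-determines-< (left _ m) (left p m′) {zero}  _ _ _ j<′ _ = all-nth p j<′
merged-determines-< (left _ m) (left _ m′) {suc i} (s≤s i<) j< (s≤s i<′) j<′ lt =
  merged-determines-< m m′ i< j< i<′ j<′ lt
merged-determines-< (right p m) (right _ m′) {j = zero} i< _ _ _ lt = contradiction lt (<-asym (all-nth p i<))
merged-determines-< (right _ m) (right _ m′) {j = suc j} i< (s≤s j<) i<′ (s≤s j<′) lt =
  merged-determines-< m m′ i< j< i<′ j<′ lt

-- Blocks are concatenated from left to right; closed leaves out the last one.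
assemble closed : ∀ {A : Set} → (Bool → ℕ → List A) → ∀ {s} → Code s → List A
assemble β c = closed β c ++ β (dir c) (suc (span c))
closed β base      = []
closed β (ext c)   = closed β c
closed β (new _ c) = assemble β c

-- Pattern words of codes

block : Bool → ℕ → List Bool
block d k = replicate k d ++ replicate k (not d)

patternWord : ∀ {s} → Code s → List Bool
patternWord = assemble block

applyUpTo-+ : ∀ {A : Set} (f : ℕ → A) m n → applyUpTo f (m + n) ≡ applyUpTo f m ++ applyUpTo (f ∘ (m +_)) n
applyUpTo-+ f zero    n = refl
applyUpTo-+ f (suc m) n = cong (f 0 ∷_) (applyUpTo-+ (f ∘ suc) m n)

-- One inequality is the gap itself. The other follows from the last block, where vertex `s` of the
-- leading edge precedes the first block vertex of the other edge and thus also its new vertex.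
gap⇒<-new : ∀ {s r} (c : Code s) {f g} → suc s < r → Increasing r f → Increasing r g →
            Realises c f g → Gap c f g → f s < g (suc s) × g s < f (suc s)
gap⇒<-new {s} c s<r incf incg R G with dir c | realises⇒block c R
... | true  | B = <-trans (<-≤-trans B (increasing⇒≤ incg (start≤ c) (<-trans (n<1+n s) s<r))) (incg (n<1+n s) s<r) , G
... | false | B = G , <-trans (<-≤-trans B (increasing⇒≤ incf (start≤ c) (<-trans (n<1+n s) s<r))) (incf (n<1+n s) s<r)

-- The last block is thereby separated from all closed ones, which allows their words to be
-- concatenated.
closed-before : ∀ {s r} (c : Code s) {f g} → s < r → Increasing r f → Increasing r g → Realises c f g →
                ∀ {i} → i < start c → f i < g (start c) × g i < f (start c)
closed-before (ext {s} c) s<r incf incg (R , _) = closed-before c (<-trans (n<1+n s) s<r) incf incg R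
closed-before (new {s} _ c) s<r incf incg (R , G , _) (s≤s i≤s)
  with p , q ← gap⇒<-new c s<r incf incg R G
  = ≤-<-trans (increasing⇒≤ incf i≤s s<r′) p , ≤-<-trans (increasing⇒≤ incg i≤s s<r′) q
  where s<r′ = <-trans (n<1+n s) s<r

all-applyUpTo₂ : ∀ {f g : ℕ → ℕ} m n → (∀ {i j} → i < m → j < n → f i < g j) →
                 All (λ a → All (a <_) (applyUpTo g n)) (applyUpTo f m)
all-applyUpTo₂ {f} {g} m n lt = All.applyUpTo⁺₁ f m (λ i< → All.applyUpTo⁺₁ g n (lt i<))

merged-applyUpTo : ∀ {r f g} i k → i + k < r → Increasing r f → Increasing r g → f (i + k) < g i →
                   Merged (applyUpTo (f ∘ (i +_)) (suc k)) (applyUpTo (g ∘ (i +_)) (suc k)) (block true (suc k))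
merged-applyUpTo {r} {f} {g} i k i+k<r incf incg lt =
  subst₂ (λ m n → Merged (applyUpTo (f ∘ (i +_)) (suc k)) (applyUpTo (g ∘ (i +_)) (suc k))
                    (replicate m true ++ replicate n false))
    (length-applyUpTo (f ∘ (i +_)) (suc k)) (length-applyUpTo (g ∘ (i +_)) (suc k))
    (merged-separated (all-applyUpTo₂ (suc k) (suc k) λ {a} {b} a< b< →
      ≤-<-trans (increasing⇒≤ incf (in-block a<) i+k<r)
        (<-≤-trans lt (increasing⇒≤ incg (m≤m+n i b) (≤-<-trans (in-block b<) i+k<r)))))
  where
  in-block : ∀ {a} → a < suc k → i + a ≤ i + k
  in-block a< = +-monoʳ-≤ i (s≤s⁻¹ a<)

map-not-block : ∀ d k → map not (block d k) ≡ block (not d) k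
map-not-block d k = trans (map-++ not (replicate k d) (replicate k (not d)))
  (cong₂ _++_ (map-replicate not k d) (map-replicate not k (not d)))

merged-block : ∀ d {r f g} i k → i + k < r → Increasing r f → Increasing r g → Before d (i + k) i f g →
               Merged (applyUpTo (f ∘ (i +_)) (suc k)) (applyUpTo (g ∘ (i +_)) (suc k)) (block d (suc k))
merged-block true  i k i+k<r incf incg lt = merged-applyUpTo i k i+k<r incf incg lt
merged-block false i k i+k<r incf incg lt =
  subst (Merged _ _) (map-not-block true (suc k)) (merged-swap (merged-applyUpTo i k i+k<r incg incf lt))

merged-patternWord : ∀ {s r} (c : Code s) {f g} → s < r → Increasing r f → Increasing r g → Realises c f g →
                     Merged (applyUpTo f (suc s)) (applyUpTo g (suc s)) (patternWord c)
merged-closed : ∀ {s r} (c : Code s) {f g} → s < r → Increasing r f → Increasing r g → Realises c f g →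
                    Merged (applyUpTo f (start c)) (applyUpTo g (start c)) (closed block c)
merged-patternWord {s} {r} c {f} {g} s<r incf incg R =
  subst (λ n → Merged (applyUpTo f n) (applyUpTo g n) (patternWord c)) start+suc-span
    (subst₂ (λ X Y → Merged X Y (patternWord c)) (sym (applyUpTo-+ f (start c) (suc (span c))))
      (sym (applyUpTo-+ g (start c) (suc (span c))))
      (merged-++ (merged-closed c s<r incf incg R)
        (merged-block (dir c) (start c) (span c) (subst (_< r) (sym (start+span c)) s<r) incf incg
          (subst (λ i → Before (dir c) i (start c) f g) (sym (start+span c)) (realises⇒block c R)))
        (all-applyUpTo₂ _ _ λ i< j< → <-≤-trans (proj₁ (before i<)) (increasing⇒≤ incg (m≤m+n _ _) (in-range j<)))
        (all-applyUpTo₂ _ _ λ i< j< → <-≤-trans (proj₂ (before i<)) (increasing⇒≤ incf (m≤m+n _ _) (in-range j<)))))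
  where
  start+suc-span : start c + suc (span c) ≡ suc s
  start+suc-span = trans (+-suc (start c) (span c)) (cong suc (start+span c))
  before : ∀ {i} → i < start c → f i < g (start c) × g i < f (start c)
  before = closed-before c s<r incf incg R
  in-range : ∀ {j} → j < suc (span c) → start c + j < r
  in-range j< = <-≤-trans (+-monoʳ-< (start c) j<) (≤-trans (≤-reflexive start+suc-span) s<r)
merged-closed base      s<r incf incg R = []
merged-closed (ext {s} c)   s<r incf incg (R , _) = merged-closed c (<-trans (n<1+n s) s<r) incf incg R
merged-closed (new {s} d c) s<r incf incg (R , _) = merged-patternWord c (<-trans (n<1+n s) s<r) incf incg R

-- Vertices of edges in a matching

occurrences : ∀ {n} → Fin n → ℕ → List (Fin n) → List ℕ
occurrences x o []      = []
occurrences x o (c ∷ l) with does (c ≟ᶠ x)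
... | true  = o ∷ occurrences x (suc o) l
... | false = occurrences x (suc o) l

≤-occurrences : ∀ {n} (x : Fin n) o l → All (o ≤_) (occurrences x o l)
≤-occurrences x o []      = []
≤-occurrences x o (c ∷ l) with does (c ≟ᶠ x)
... | true  = ≤-refl ∷ All.map (≤-trans (n≤1+n o)) (≤-occurrences x (suc o) l)
... | false = All.map (≤-trans (n≤1+n o)) (≤-occurrences x (suc o) l)

occurrences-sorted : ∀ {n} (x : Fin n) o l → AllPairs _<_ (occurrences x o l)
occurrences-sorted x o []      = []
occurrences-sorted x o (c ∷ l) with does (c ≟ᶠ x)
... | true  = ≤-occurrences x (suc o) l ∷ occurrences-sorted x (suc o) l
... | false = occurrences-sorted x (suc o) l

length-occurrences : ∀ {n m} (x : Fin n) o (v : Vec (Fin n) m) →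
                     length (occurrences x o (toList v)) ≡ Vec.count (_≟ᶠ x) v
length-occurrences x o Vec.[]      = refl
length-occurrences x o (c Vec.∷ v) with does (c ≟ᶠ x)
... | true  = cong suc (length-occurrences x (suc o) v)
... | false = length-occurrences x (suc o) v

-- This is `pairWord` for an arbitrary list of edges, so that it can be computed block by block.
restrict : ∀ {n} → Fin n → Fin n → List (Fin n) → List Bool
restrict x y l = map (λ c → does (c ≟ᶠ x)) (filter (λ c → (c ≟ᶠ x) ⊎-dec (c ≟ᶠ y)) l)

merged-restrict : ∀ {n} {x y : Fin n} → x ≢ y → ∀ o l →
                  Merged (occurrences x o l) (occurrences y o l) (restrict x y l)
merged-restrict x≢y o [] = []
merged-restrict {x = x} {y} x≢y o (c ∷ l) with c ≟ᶠ x in eq | c ≟ᶠ y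
... | yes refl | yes refl = contradiction refl x≢y
... | yes _ | no _  rewrite eq = left (≤-occurrences y (suc o) l) (merged-restrict x≢y (suc o) l)
... | no _  | yes _ rewrite eq = right (≤-occurrences x (suc o) l) (merged-restrict x≢y (suc o) l)
... | no _  | no _  = merged-restrict x≢y (suc o) l

module _ {r n} (M : Matching r n) where

  vertices : Fin n → List ℕ
  vertices x = occurrences x 0 (toList (word M))

  vertex : Fin n → ℕ → ℕ
  vertex x = nth (vertices x)

  length-vertices : ∀ x → length (vertices x) ≡ r
  length-vertices x = trans (length-occurrences x 0 (word M)) (regular M x)

  vertex-increasing : ∀ x → Increasing r (vertex x)
  vertex-increasing x = subst (λ k → Increasing k (vertex x)) (length-vertices x)
    (increasing-nth (occurrences-sorted x 0 (toList (word M))))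

  merged-pairWord : ∀ {x y} → x ≢ y → Merged (vertices x) (vertices y) (pairWord M x y)
  merged-pairWord x≢y = merged-restrict x≢y 0 (toList (word M))

  in-vertices : ∀ x {i} → i < r → i < length (vertices x)
  in-vertices x = subst (_ <_) (sym (length-vertices x))

  vertex-disjoint : ∀ {x y} → x ≢ y → ∀ {i j} → i < r → j < r → vertex x i ≢ vertex y j
  vertex-disjoint {x} {y} x≢y i< j< = merged-disjoint (merged-pairWord x≢y) (in-vertices x i<) (in-vertices y j<)

  applyUpTo-vertex : ∀ x → applyUpTo (vertex x) r ≡ vertices x
  applyUpTo-vertex x = subst (λ k → applyUpTo (vertex x) k ≡ vertices x) (length-vertices x) (applyUpTo-nth (vertices x))

  pairWord-swap : ∀ {x y} → x ≢ y → pairWord M y x ≡ map not (pairWord M x y)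
  pairWord-swap x≢y = merged-unique (merged-pairWord (x≢y ∘ sym)) (merged-swap (merged-pairWord x≢y))

  forms-swap : ∀ {x y P} → x ≢ y → Forms M x y P → Forms M y x P
  forms-swap {P = P} x≢y (inj₁ eq) = inj₂ (trans (pairWord-swap x≢y) (cong (map not) eq))
  forms-swap {P = P} x≢y (inj₂ eq) = inj₁ (trans (pairWord-swap x≢y) (trans (cong (map not) eq) (map-not-involutive P)))

  pairWord-isPattern : ∀ {x y} → x ≢ y →
    length (pairWord M x y) ≡ 2 * r × length (filter (_≟ᵇ true) (pairWord M x y)) ≡ r
  pairWord-isPattern {x} {y} x≢y with p , q ← merged-length (merged-pairWord x≢y) =
    trans p (cong₂ _+_ (length-vertices x) (trans (length-vertices y) (sym (+-identityʳ r)))) , trans q (length-vertices x)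

realises⇒pairWord : ∀ {s n} (M : Matching (suc s) n) (c : Code s) {x y} →
                    Realises c (vertex M x) (vertex M y) → x ≢ y → pairWord M x y ≡ patternWord c
realises⇒pairWord {s} M c {x} {y} R x≢y = merged-unique (merged-pairWord M x≢y)
  (subst₂ (λ X Y → Merged X Y (patternWord c)) (applyUpTo-vertex M x) (applyUpTo-vertex M y)
    (merged-patternWord c (n<1+n s) (vertex-increasing M x) (vertex-increasing M y) R))

-- Realising a code is a conjunction of comparisons between vertices of the two edges, and each of
-- them can be read off the pair word.
realises-transfer : ∀ {r m n} (M : Matching r m) (N : Matching r n) {x y u v} → x ≢ y → u ≢ v →
                    pairWord M x y ≡ pairWord N u v → ∀ {s} (c : Code s) → s < r →
                    Realises c (vertex M x) (vertex M y) → Realises c (vertex N u) (vertex N v)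
realises-transfer {r} M N {x} {y} {u} {v} x≢y u≢v eq = go
  where
  xy-less : ∀ {i j} → i < r → j < r → vertex M x i < vertex M y j → vertex N u i < vertex N v j
  xy-less i< j< = merged-determines-< (merged-pairWord M x≢y)
    (subst (Merged _ _) (sym eq) (merged-pairWord N u≢v))
    (in-vertices M x i<) (in-vertices M y j<) (in-vertices N u i<) (in-vertices N v j<)
  yx-less : ∀ {i j} → i < r → j < r → vertex M y i < vertex M x j → vertex N v i < vertex N u j
  yx-less i< j< = merged-determines-< (merged-swap (merged-pairWord M x≢y))
    (subst (Merged _ _) (cong (map not) (sym eq)) (merged-swap (merged-pairWord N u≢v)))
    (in-vertices M y i<) (in-vertices M x j<) (in-vertices N v i<) (in-vertices N u j<)
  before : ∀ d {i j} → i < r → j < r → Before d i j (vertex M x) (vertex M y) → Before d i j (vertex N u) (vertex N v)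
  before true  = xy-less
  before false = yx-less
  go : ∀ {s} (c : Code s) → s < r → Realises c (vertex M x) (vertex M y) → Realises c (vertex N u) (vertex N v)
  go base      s<r R       = xy-less s<r s<r R
  go (ext {s} c) s<r (R , B) = go c (<-trans (n<1+n s) s<r) R , before (dir c) s<r (≤-<-trans (start≤ (ext c)) s<r) B
  go (new {s} d c) s<r (R , G , B) = go c (<-trans (n<1+n s) s<r) R ,
    before (not (dir c)) (<-trans (n<1+n s) s<r) s<r G , before d s<r s<r B

-- Last runs and injectivity of pattern words

replicate-∷ʳ : ∀ {A : Set} k (x : A) → replicate k x ∷ʳ x ≡ x ∷ replicate k x
replicate-∷ʳ zero    x = refl
replicate-∷ʳ (suc k) x = cong (x ∷_) (replicate-∷ʳ k x)

reverse-replicate : ∀ {A : Set} k (x : A) → reverse (replicate k x) ≡ replicate k x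
reverse-replicate zero    x = refl
reverse-replicate (suc k) x = trans (unfold-reverse x (replicate k x))
  (trans (cong (_∷ʳ x) (reverse-replicate k x)) (replicate-∷ʳ k x))

-- This exposes the last run: it is the second half of the last block, and the letter `dir c` of the
-- first half stops it.
reverse-patternWord : ∀ {s} (c : Code s) → ∃ λ u →
  reverse (patternWord c) ≡ not (dir c) ∷ replicate (span c) (not (dir c)) ++ dir c ∷ u
reverse-patternWord c = replicate k d ++ reverse (closed block c) , (begin
  reverse (closed block c ++ block d (suc k))
    ≡⟨ reverse-++ (closed block c) _ ⟩
  reverse (block d (suc k)) ++ v
    ≡⟨ cong (_++ v) (reverse-++ (replicate (suc k) d) _) ⟩
  (reverse (replicate (suc k) (not d)) ++ reverse (replicate (suc k) d)) ++ v
    ≡⟨ cong₂ (λ t u → (t ++ u) ++ v) (reverse-replicate (suc k) (not d)) (reverse-replicate (suc k) d) ⟩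
  (replicate (suc k) (not d) ++ replicate (suc k) d) ++ v
    ≡⟨ ++-assoc (replicate (suc k) (not d)) _ _ ⟩
  replicate (suc k) (not d) ++ replicate (suc k) d ++ v  ∎)
  where
  open ≡-Reasoning
  d = dir c
  k = span c
  v = reverse (closed block c)

lastRun-reverse : ∀ w {x xs} → reverse w ≡ x ∷ xs → lastRun w ≡ suc (runFrom x xs)
lastRun-reverse w eq with reverse w
lastRun-reverse w refl | _ = refl

runFrom-replicate : ∀ d k u → runFrom (not d) (replicate k (not d) ++ d ∷ u) ≡ k
runFrom-replicate true  zero    u = refl
runFrom-replicate false zero    u = refl
runFrom-replicate true  (suc k) u = cong suc (runFrom-replicate true k u)
runFrom-replicate false (suc k) u = cong suc (runFrom-replicate false k u)

lastRun-patternWord : ∀ {s} (c : Code s) → lastRun (patternWord c) ≡ suc (span c)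
lastRun-patternWord c with u , eq ← reverse-patternWord c =
  trans (lastRun-reverse (patternWord c) eq) (cong suc (runFrom-replicate (dir c) (span c) u))

maturity-patternWord : ∀ {s} (c : Code s) → maturity (patternWord c) ≡ span c ∸ 1
maturity-patternWord c = cong (_∸ 2) (lastRun-patternWord c)

-- The last letter of a pattern word reveals the direction of the last block and the last run its
-- span. Once that block is cancelled the closed parts are compared, and the span tells `ext` from
-- `new`.
closed-injective : ∀ {s} (c d : Code s) → dir c ≡ dir d → span c ≡ span d → closed block c ≡ closed block d → c ≡ d
patternWord-injective : ∀ {s} (c d : Code s) → patternWord c ≡ patternWord d → c ≡ d

closed-injective base      base        _    _  _  = refl
closed-injective (ext c)   (ext d)     dir≡ sp eq = cong ext (closed-injective c d dir≡ (suc-injective sp) eq)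
closed-injective (new _ c) (new _ d)   refl _  eq = cong (new _) (patternWord-injective c d eq)

patternWord-injective c d eq = closed-injective c d dir≡ span≡
  (++-cancelʳ (block (dir c) (suc (span c))) _ _
    (trans eq (cong₂ (λ e k → closed block d ++ block e (suc k)) (sym dir≡) (sym span≡))))
  where
  dir≡ : dir c ≡ dir d
  dir≡ with _ , eqc ← reverse-patternWord c | _ , eqd ← reverse-patternWord d =
    not-injective (∷-injectiveˡ (trans (sym eqc) (trans (cong reverse eq) eqd)))
  span≡ : span c ≡ span d
  span≡ = suc-injective (trans (sym (lastRun-patternWord c)) (trans (cong lastRun eq) (lastRun-patternWord d)))

patternWord-starts : ∀ {s} (c : Code s) → ∃ λ t → patternWord c ≡ true ∷ t
-- As long as no block is closed, the code is `base` grown by `ext`, and its direction is still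
-- `true`.
closed-starts : ∀ {s} (c : Code s) → (closed block c ≡ [] × dir c ≡ true) ⊎ ∃ λ t → closed block c ≡ true ∷ t
patternWord-starts c with closed-starts c
... | inj₁ (eq , dir≡) = _ , cong₂ (λ u d → u ++ block d (suc (span c))) eq dir≡
... | inj₂ (_ , eq)    = _ , cong (_++ block (dir c) (suc (span c))) eq
closed-starts base      = inj₁ (refl , refl)
closed-starts (ext c)   = closed-starts c
closed-starts (new _ c) = inj₂ (patternWord-starts c)

codes-unique : ∀ s → Unique (codes s)
codes-unique zero    = [] ∷ []
codes-unique (suc s) = Unique.++⁺ (Unique.map⁺ (λ { refl → refl }) (codes-unique s))
  (Unique.++⁺ (Unique.map⁺ (λ { refl → refl }) (codes-unique s)) (Unique.map⁺ (λ { refl → refl }) (codes-unique s))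
    new-disjoint) ext-disjoint
  where
  new-disjoint : ∀ {c} → ¬ (c ∈ map (new true) (codes s) × c ∈ map (new false) (codes s))
  new-disjoint (p , q) with _ , _ , refl ← ∈-map⁻ _ p | _ , _ , () ← ∈-map⁻ _ q
  ext-disjoint : ∀ {c} → ¬ (c ∈ map ext (codes s) × c ∈ map (new true) (codes s) ++ map (new false) (codes s))
  ext-disjoint (p , q) with _ , _ , refl ← ∈-map⁻ _ p | ∈-++⁻ (map (new true) (codes s)) q
  ... | inj₁ q′ with _ , _ , () ← ∈-map⁻ _ q′
  ... | inj₂ q′ with _ , _ , () ← ∈-map⁻ _ q′

-- The block sizes add up to `suc s`. This yields both the length of a standard clique (`m` the
-- number of edges) and the number of occurrences of an edge (`m = 1`).
assemble-additive : ∀ {A : Set} (μ : List A → ℕ) (β : Bool → ℕ → List A) m → μ [] ≡ 0 →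
  (∀ u v → μ (u ++ v) ≡ μ u + μ v) → (∀ d k → μ (β d k) ≡ k * m) →
  ∀ {s} (c : Code s) → μ (assemble β c) ≡ suc s * m
assemble-additive μ β m μ-[] μ-++ μ-β = assembled
  where
  assembled : ∀ {s} (c : Code s) → μ (assemble β c) ≡ suc s * m
  closed-start : ∀ {s} (c : Code s) → μ (closed β c) ≡ start c * m
  assembled {s} c = begin
    μ (closed β c ++ β (dir c) (suc (span c)))     ≡⟨ μ-++ _ _ ⟩
    μ (closed β c) + μ (β (dir c) (suc (span c)))  ≡⟨ cong₂ _+_ (closed-start c) (μ-β _ _) ⟩
    start c * m + suc (span c) * m                 ≡⟨ *-distribʳ-+ m (start c) (suc (span c)) ⟨
    (start c + suc (span c)) * m                   ≡⟨ cong (_* m) (+-suc (start c) (span c)) ⟩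
    suc (start c + span c) * m                     ≡⟨ cong (λ t → suc t * m) (start+span c) ⟩
    suc s * m                                      ∎
    where open ≡-Reasoning
  closed-start base      = μ-[]
  closed-start (ext c)   = closed-start c
  closed-start (new _ c) = assembled c

assemble-hom : ∀ {A B : Set} (h : List A → List B) (β : Bool → ℕ → List A) (γ : Bool → ℕ → List B) → h [] ≡ [] →
  (∀ u v → h (u ++ v) ≡ h u ++ h v) → (∀ d k → h (β d k) ≡ γ d k) →
  ∀ {s} (c : Code s) → h (assemble β c) ≡ assemble γ c
assemble-hom h β γ h-[] h-++ h-β = assembled
  where
  assembled : ∀ {s} (c : Code s) → h (assemble β c) ≡ assemble γ c
  closed′ : ∀ {s} (c : Code s) → h (closed β c) ≡ closed γ c
  assembled c = trans (h-++ _ _) (cong₂ _++_ (closed′ c) (h-β _ _))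
  closed′ base      = h-[]
  closed′ (ext c)   = closed′ c
  closed′ (new _ c) = assembled c

repeatEach : ∀ {A : Set} → ℕ → List A → List A
repeatEach k = concatMap (replicate k)

length-repeatEach : ∀ {A : Set} k (l : List A) → length (repeatEach k l) ≡ k * length l
length-repeatEach k []      = sym (*-zeroʳ k)
length-repeatEach k (x ∷ l) = trans (length-++ (replicate k x))
  (trans (cong₂ _+_ (length-replicate k) (length-repeatEach k l)) (sym (*-suc k (length l))))

map-repeatEach : ∀ {A B : Set} (f : A → B) k l → map f (repeatEach k l) ≡ repeatEach k (map f l)
map-repeatEach f k []      = refl
map-repeatEach f k (x ∷ l) = trans (map-++ f (replicate k x) _) (cong₂ _++_ (map-replicate f k x) (map-repeatEach f k l))

filter-repeatEach : ∀ {A : Set} {P : Pred A 0ℓ} (P? : Decidable₁ P) k l →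
                    filter P? (repeatEach k l) ≡ repeatEach k (filter P? l)
filter-repeatEach P? k [] = refl
filter-repeatEach P? k (x ∷ l) with P? x
... | yes Px = trans (filter-++ P? (replicate k x) _)
                 (cong₂ _++_ (filter-all P? (All.replicate⁺ k Px)) (filter-repeatEach P? k l))
... | no ¬Px = trans (filter-++ P? (replicate k x) _)
                 (cong₂ _++_ (filter-none P? (All.replicate⁺ k ¬Px)) (filter-repeatEach P? k l))

filter-single : ∀ {A : Set} {P : Pred A 0ℓ} (P? : Decidable₁ P) {y l} → Unique l → y ∈ l → P y →
                All (λ z → P z → z ≡ y) l → filter P? l ≡ y ∷ []
filter-single P? {y} (y∉l ∷ _) (here refl) Py (_ ∷ only) =
  trans (filter-accept P? Py) (cong (y ∷_) (filter-none P? (All.zipWith (λ (y≢z , h) Pz → y≢z (sym (h Pz))) (y∉l , only))))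
filter-single P? (x∉l ∷ u) (there y∈l) Py (h ∷ only) =
  trans (filter-reject P? (λ Px → All.lookup x∉l y∈l (h Px))) (filter-single P? u y∈l Py only)

-- Cliques of a given code

-- A block AᵏBᵏ of the pattern becomes a list of all edges in increasing order, a block BᵏAᵏ one in
-- decreasing order.
edgeOrder : ∀ {k} → Bool → List (Fin k)
edgeOrder true  = allFin _
edgeOrder false = tabulate opposite

Earlier : ∀ {k} → Bool → Rel (Fin k) 0ℓ
Earlier true  = Fin._<_
Earlier false = flip Fin._<_

edgeOrder-sorted : ∀ {k} d → AllPairs (Earlier {k} d) (edgeOrder d)
edgeOrder-sorted true  = AllPairs.tabulate⁺-< id
edgeOrder-sorted {k} false = AllPairs.tabulate⁺-< {f = opposite} λ {i} {j} i<j →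
  subst₂ _<_ (sym (opposite-prop j)) (sym (opposite-prop i)) (∸-monoʳ-< (s≤s i<j) (toℕ<n j))

earlier⇒≢ : ∀ {k} d {x y : Fin k} → Earlier d x y → x ≢ y
earlier⇒≢ true  lt refl = <-irrefl refl lt
earlier⇒≢ false lt refl = <-irrefl refl lt

earlier-asym : ∀ {k} d → Asymmetric (Earlier {k} d)
earlier-asym true  = <-asym
earlier-asym false = <-asym

∈-edgeOrder : ∀ {k} d (x : Fin k) → x ∈ edgeOrder d
∈-edgeOrder true  x = ∈-allFin x
∈-edgeOrder false x = subst (_∈ tabulate opposite) (opposite-involutive x) (∈-tabulate⁺ (opposite x))

length-edgeOrder : ∀ {k} d → length (edgeOrder {k} d) ≡ k
length-edgeOrder true  = length-tabulate id
length-edgeOrder false = length-tabulate opposite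

edgeOrder-unique : ∀ {k} d → Unique (edgeOrder {k} d)
edgeOrder-unique d = AllPairs.map (earlier⇒≢ d) (edgeOrder-sorted d)

restrict-++ : ∀ {n} (x y : Fin n) u v → restrict x y (u ++ v) ≡ restrict x y u ++ restrict x y v
restrict-++ x y u v = trans (cong (map _) (filter-++ _ u v)) (map-++ _ (filter _ u) _)

restrict-repeatEach : ∀ {n} (x y : Fin n) k l → restrict x y (repeatEach k l) ≡ repeatEach k (restrict x y l)
restrict-repeatEach x y k l = trans (cong (map _) (filter-repeatEach _ k l)) (map-repeatEach _ k (filter _ l))

filter-pair : ∀ {n} d {x y : Fin n} {l} → AllPairs (Earlier d) l → x ∈ l → y ∈ l → Earlier d x y →
              filter (λ c → (c ≟ᶠ x) ⊎-dec (c ≟ᶠ y)) l ≡ x ∷ y ∷ []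
filter-pair d _ (here refl) (here refl) x<y = contradiction refl (earlier⇒≢ d x<y)
filter-pair d {x} {y} (x<l ∷ sorted) (here refl) (there y∈l) x<y =
  trans (filter-accept P? (inj₁ refl)) (cong (x ∷_)
    (filter-single P? (AllPairs.map (earlier⇒≢ d) sorted) y∈l (inj₂ refl)
      (All.map (λ x<z → [ (λ z≡x → contradiction (sym z≡x) (earlier⇒≢ d x<z)) , id ]) x<l)))
  where P? = λ c → (c ≟ᶠ x) ⊎-dec (c ≟ᶠ y)
filter-pair d (y<l ∷ _) (there x∈l) (here refl) x<y = contradiction (All.lookup y<l x∈l) (earlier-asym d x<y)
filter-pair d {x} {y} (c<l ∷ sorted) (there x∈l) (there y∈l) x<y =
  trans (filter-reject P? [ earlier⇒≢ d (All.lookup c<l x∈l) , earlier⇒≢ d (All.lookup c<l y∈l) ])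
    (filter-pair d sorted x∈l y∈l x<y)
  where P? = λ c → (c ≟ᶠ x) ⊎-dec (c ≟ᶠ y)

edgeBlock : ∀ {n} → Bool → ℕ → List (Fin n)
edgeBlock d k = repeatEach k (edgeOrder d)

restrict-earlier : ∀ {n} d {x y : Fin n} → Earlier d x y → ∀ k → restrict x y (edgeBlock d k) ≡ block true k
restrict-earlier d {x} {y} x<y k = begin
  restrict x y (repeatEach k (edgeOrder d))
    ≡⟨ restrict-repeatEach x y k (edgeOrder d) ⟩
  repeatEach k (restrict x y (edgeOrder d))
    ≡⟨ cong (λ l → repeatEach k (map (λ c → does (c ≟ᶠ x)) l))
         (filter-pair d (edgeOrder-sorted d) (∈-edgeOrder d x) (∈-edgeOrder d y) x<y) ⟩
  repeatEach k (does (x ≟ᶠ x) ∷ does (y ≟ᶠ x) ∷ [])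
    ≡⟨ cong₂ (λ a b → repeatEach k (a ∷ b ∷ [])) (dec-true (x ≟ᶠ x) refl) (dec-false (y ≟ᶠ x) (earlier⇒≢ d x<y ∘ sym)) ⟩
  replicate k true ++ replicate k false ++ []
    ≡⟨ cong (replicate k true ++_) (++-identityʳ _) ⟩
  replicate k true ++ replicate k false ∎
  where open ≡-Reasoning

restrict-edgeBlock : ∀ {n} {x y : Fin n} → x Fin.< y → ∀ d k → restrict x y (edgeBlock d k) ≡ block d k
restrict-edgeBlock x<y true  k = restrict-earlier true x<y k
restrict-edgeBlock {x = x} {y} x<y false k = begin
  -- In decreasing order `y` comes first, so the word is computed for `y`, `x` and its letters are
  -- exchanged.
  restrict x y (edgeBlock false k)
    ≡⟨ merged-unique (merged-restrict x≢y 0 l) (merged-swap (merged-restrict (x≢y ∘ sym) 0 l)) ⟩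
  map not (restrict y x (edgeBlock false k)) ≡⟨ cong (map not) (restrict-earlier false x<y k) ⟩
  map not (block true k)                     ≡⟨ map-not-block true k ⟩
  block false k                              ∎
  where
  open ≡-Reasoning
  x≢y = earlier⇒≢ true x<y
  l = edgeBlock false k

count-edgeBlock : ∀ {n} (x : Fin n) d k → length (filter (_≟ᶠ x) (edgeBlock d k)) ≡ k * 1
count-edgeBlock x d k = begin
  length (filter (_≟ᶠ x) (repeatEach k (edgeOrder d)))  ≡⟨ cong length (filter-repeatEach (_≟ᶠ x) k (edgeOrder d)) ⟩
  length (repeatEach k (filter (_≟ᶠ x) (edgeOrder d)))  ≡⟨ length-repeatEach k (filter (_≟ᶠ x) (edgeOrder d)) ⟩
  k * length (filter (_≟ᶠ x) (edgeOrder d))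
    ≡⟨ cong (λ l → k * length l) (filter-single (_≟ᶠ x) (edgeOrder-unique d)
         (∈-edgeOrder d x) refl (All.universal (λ _ → id) _)) ⟩
  k * 1 ∎
  where open ≡-Reasoning

count-fromList : ∀ {A : Set} {P : Pred A 0ℓ} (P? : Decidable₁ P) {m} (l : List A) (eq : length l ≡ m) →
                 Vec.count P? (subst (Vec A) eq (fromList l)) ≡ length (filter P? l)
count-fromList P? []      refl = refl
count-fromList P? (x ∷ l) refl with does (P? x)
... | true  = cong suc (count-fromList P? l refl)
... | false = count-fromList P? l refl

toList-subst : ∀ {A : Set} {m} (l : List A) (eq : length l ≡ m) → toList (subst (Vec A) eq (fromList l)) ≡ l
toList-subst l refl = toList∘fromList l

length-assemble-edgeBlock : ∀ {s} (c : Code s) n → length (assemble (edgeBlock {n}) c) ≡ suc s * n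
length-assemble-edgeBlock c n = assemble-additive length edgeBlock n refl (λ u v → length-++ u)
  (λ d k → trans (length-repeatEach k (edgeOrder d)) (cong (k *_) (length-edgeOrder d))) c

-- Every block of the pattern is blown up to all `n` edges at once, each repeated as often as the
-- block size says. All pairs then see the same pattern, so it is collectable.
standardClique : ∀ {s} → Code s → ∀ n → Matching (suc s) n
standardClique {s} c n = mkMatching (subst (Vec (Fin n)) (length-assemble-edgeBlock c n) (fromList l)) regular′
  where
  l = assemble edgeBlock c
  regular′ : ∀ x → Vec.count (_≟ᶠ x) (subst (Vec (Fin n)) (length-assemble-edgeBlock c n) (fromList l)) ≡ suc s
  regular′ x = trans (count-fromList (_≟ᶠ x) l (length-assemble-edgeBlock c n))
    (trans (assemble-additive (length ∘ filter (_≟ᶠ x)) edgeBlock 1 refl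
             (λ u v → trans (cong length (filter-++ (_≟ᶠ x) u v)) (length-++ (filter (_≟ᶠ x) u)))
             (count-edgeBlock x) c)
           (*-identityʳ (suc s)))

pairWord-standardClique : ∀ {s} (c : Code s) n {x y} → x Fin.< y → pairWord (standardClique c n) x y ≡ patternWord c
pairWord-standardClique c n {x} {y} x<y =
  trans (cong (restrict x y) (toList-subst (assemble edgeBlock c) (length-assemble-edgeBlock c n)))
    (assemble-hom (restrict x y) edgeBlock block refl (restrict-++ x y) (restrict-edgeBlock x<y) c)

patternWord-collectable : ∀ {s} (c : Code s) → Collectable (suc s) (patternWord c)
patternWord-collectable c n _ = standardClique c n , forms
  where
  forms : IsClique (standardClique c n) (patternWord c)
  forms x y x≢y with Fin.<-cmp x y
  ... | tri< x<y _ _ = inj₁ (pairWord-standardClique c n x<y)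
  ... | tri≈ _ x≡y _ = contradiction x≡y x≢y
  ... | tri> _ _ y<x = forms-swap (standardClique c n) (x≢y ∘ sym) (inj₁ (pairWord-standardClique c n y<x))

-- The letter counts are inherited from the standard clique of size two, whose pair word this is.
patternWord-isPattern : ∀ {s} (c : Code s) → IsPattern (suc s) (patternWord c)
patternWord-isPattern {s} c =
  subst (λ w → length w ≡ 2 * suc s × length (filter (_≟ᵇ true) w) ≡ suc s × ∃ λ t → w ≡ true ∷ t)
    pair≡ (proj₁ lengths , proj₂ lengths , subst (λ w → ∃ λ t → w ≡ true ∷ t) (sym pair≡) (patternWord-starts c))
  where
  M = standardClique c 2
  pair≡ : pairWord M zero (suc zero) ≡ patternWord c
  pair≡ = pairWord-standardClique c 2 (s≤s z≤n)
  lengths = pairWord-isPattern M {zero} {suc zero} (λ ())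

-- Products of the bounds

prodFin≡product : ∀ {N} (a : Fin N → ℕ) → prodFin a ≡ product (map a (allFin N))
prodFin≡product a = trans (tabulated a) (cong product (sym (map-tabulate id a)))
  where
  tabulated : ∀ {N} (a : Fin N → ℕ) → prodFin a ≡ product (tabulate a)
  tabulated {zero}  a = refl
  tabulated {suc N} a = cong (a zero *_) (tabulated (a ∘ suc))

-- Each entry of `xs` is removed once from `ys`, and the factors left over are at least 1. This
-- compares the product over the codes with the product over all given patterns.
product-⊆ : ∀ {A : Set} (f : A → ℕ) → (∀ x → 1 ≤ f x) → ∀ {xs ys} → Unique xs → xs ⊆ ys →
            product (map f xs) ≤ product (map f ys)
product-⊆ f 1≤f {[]} {[]}     _ _ = ≤-refl
product-⊆ f 1≤f {[]} {y ∷ ys} _ _ = *-mono-≤ (1≤f y) (product-⊆ f 1≤f {[]} {ys} [] (λ ()))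
product-⊆ f 1≤f {x ∷ xs} (x∉xs ∷ u) xs⊆ with us , vs , refl ← ∈-∃++ (xs⊆ (here refl)) =
  ≤-trans (*-monoʳ-≤ (f x) (product-⊆ f 1≤f u xs⊆rest))
    (≤-reflexive (sym (product-↭ (map⁺ f (shift x us vs)))))
  where
  xs⊆rest : xs ⊆ us ++ vs
  xs⊆rest z∈xs with ∈-resp-↭ (shift x us vs) (xs⊆ (there z∈xs))
  ... | here refl = contradiction refl (All.lookup x∉xs z∈xs)
  ... | there z∈  = z∈

allPairs⇒either : ∀ {A : Set} {R : A → A → Set} {l x y} → AllPairs R l → x ∈ l → y ∈ l → x ≢ y → R x y ⊎ R y x
allPairs⇒either _          (here refl) (here refl) x≢y = contradiction refl x≢y
allPairs⇒either (h ∷ _)    (here refl) (there y∈)  _   = inj₁ (All.lookup h y∈)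
allPairs⇒either (h ∷ _)    (there x∈)  (here refl) _   = inj₂ (All.lookup h x∈)
allPairs⇒either (_ ∷ pairs) (there x∈)  (there y∈)  x≢y = allPairs⇒either pairs x∈ y∈ x≢y

-- Cliques in arbitrary and in clean matchings

module _ {s n} (M : Matching (suc s) n) where

  open Positions (suc s) (vertex M) (vertex-increasing M) (vertex-disjoint M)

  edges-by-first-vertex : ∃ λ C → CliqueOf base C × length C ≡ n
  edges-by-first-vertex = C , AllPairs.zipWith (λ (le , x≢y) → ≤∧≢⇒< le (vertex-disjoint M x≢y z<s z<s))
      (Sorted⇒AllPairs (DecTotalOrder.totalOrder order) (sort-↗ order (allFin n)) , unique) ,
    trans (↭-length (sort-↭ order (allFin n))) (length-tabulate id)
    where
    order = On.decTotalOrder ≤-decTotalOrder (λ x → vertex M x 0)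
    C = sort order (allFin n)
    unique : Unique C
    unique = Permutation.Unique-resp-↭ (setoid (Fin n)) (↭⇒↭ₛ (↭-sym (sort-↭ order (allFin n)))) (Unique.allFin⁺ n)

  cliqueOf⇒isCliqueIn : ∀ {c : Code s} {C} → CliqueOf c C → IsCliqueIn M (patternWord c) C
  cliqueOf⇒isCliqueIn {c} {C} RC = AllPairs.map (realises⇒≢ c) RC , forms
    where
    forms : ∀ x y → x ∈ C → y ∈ C → x ≢ y → Forms M x y (patternWord c)
    forms x y x∈ y∈ x≢y with allPairs⇒either RC x∈ y∈ x≢y
    ... | inj₁ R = inj₁ (realises⇒pairWord M c R x≢y)
    ... | inj₂ R = forms-swap M (x≢y ∘ sym) (inj₁ (realises⇒pairWord M c R (x≢y ∘ sym)))

  weighted-clique : ∀ (b : Code s → ℕ) → product (map b (codes s)) < n →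
                    ∃₂ λ c C → CliqueOf c C × b c < length C * weight c
  weighted-clique b lt with C , BC , size ← edges-by-first-vertex =
    clique weight ≤-refl (λ _ _ → ≤-refl) extend-weighted s ≤-refl BC b (subst (_ <_) (sym size) lt)

  coded-clique : (∀ {x y} → x ≢ y → Coded s (vertex M x) (vertex M y)) →
                 ∀ (b : Code s → ℕ) → product (map b (codes s)) < n → ∃₂ λ c C → CliqueOf c C × b c < length C * 1
  coded-clique coded b lt with C , BC , size ← edges-by-first-vertex =
    clique (λ _ → 1) ≤-refl (λ _ _ → ≤-refl)
      -- The overlapping chain is kept whole: a code of the complete pair is cut down to the leading
      -- vertices reached so far and forces the block to grow.
      (λ c t<s ch → _ , AllPairs.map (λ {x} {y} (R , O) → R ,
         overlap∧coded⇒block c t<s (vertex-increasing M x) (vertex-increasing M y) R O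
           (coded-≤ (≤⇒≤′ (s≤s⁻¹ t<s)) (coded (realises⇒≢ c R)))) ch , ≤-refl)
      s ≤-refl BC b (subst (_ <_) (sym size) lt)

-- P has arbitrarily large cliques, and a large enough one contains two edges realising a code
-- by the weighted count, whose losses do not matter here.
collectable⇒coded : ∀ {s n} (M : Matching (suc s) n) {P x y} → Collectable (suc s) P → x ≢ y → Forms M x y P →
                    Coded s (vertex M x) (vertex M y)
collectable⇒coded {s} M {P} {x} {y} collectable x≢y formsM = coded
  where
  -- With the weights themselves as bounds, the clique found must have at least two edges. The
  -- summand 2 meets the minimal size in `Collectable` and makes the product strictly smaller than
  -- `k`.
  k = 2 + product (map weight (codes s))
  N : Matching (suc s) k
  N = proj₁ (collectable k (s≤s (s≤s z≤n)))

  coded-pair : ∀ (c : Code s) {C} → AllPairs (λ u v → Realises c (vertex N u) (vertex N v)) C →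
               weight c < length C * weight c →
               ∃₂ λ u v → u ≢ v × Realises c (vertex N u) (vertex N v)
  coded-pair c []       lt = contradiction lt λ ()
  coded-pair c (_ ∷ []) lt = contradiction lt (<-irrefl (sym (*-identityˡ (weight c))))
  coded-pair c ((R ∷ _) ∷ _ ∷ _) _ =
    _ , _ , Positions.realises⇒≢ (suc s) (vertex N) (vertex-increasing N) (vertex-disjoint N) c R , R

  -- If the two pairs match `P` under different letter correspondences, exchanging `x` and `y` makes
  -- their words agree.
  same : ∀ {u v} → Forms N u v P → Forms M x y P →
         pairWord N u v ≡ pairWord M x y ⊎ pairWord N u v ≡ pairWord M y x
  same (inj₁ p) (inj₁ q) = inj₁ (trans p (sym q))
  same (inj₂ p) (inj₂ q) = inj₁ (trans p (sym q))
  same (inj₂ p) (inj₁ q) = inj₂ (trans p (sym (trans (pairWord-swap M x≢y) (cong (map not) q))))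
  same (inj₁ p) (inj₂ q) = inj₂ (trans p (sym (trans (pairWord-swap M x≢y)
                                    (trans (cong (map not) q) (map-not-involutive P)))))

  coded : Coded s (vertex M x) (vertex M y)
  coded with c , C , RC , lt ← weighted-clique N weight (n≤1+n _)
        with u , v , u≢v , R ← coded-pair c RC lt
        with same (proj₂ (collectable k (s≤s (s≤s z≤n))) u v u≢v) formsM
  ... | inj₁ eq = c , inj₁ (realises-transfer N M u≢v x≢y eq c (n<1+n s) R)
  ... | inj₂ eq = c , inj₂ (realises-transfer N M u≢v (x≢y ∘ sym) eq c (n<1+n s) R)

theorem1p3 : ∀ (r : ℕ) → 2 ≤ r →
    ∀ (N : ℕ) (P : Fin N → List Bool) → Injective _≡_ _≡_ P →
    (∀ (w : List Bool) → (IsPattern r w × Collectable r w) ⇔ (∃ λ i → P i ≡ w)) →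
    ∀ (a : Fin N → ℕ) → (∀ i → 1 ≤ a i) →
    ∀ (n : ℕ) → prodFin a + 1 ≤ n →
    (∀ (M : Matching r n) → ∃ λ i → Σ (List (Fin n)) λ C →
    IsCliqueIn M (P i) C × a i < length C * 2 ^ maturity (P i))
    ×
    (∀ (M : Matching r n) → Clean M → ∃ λ i → Σ (List (Fin n)) λ C →
    IsCliqueIn M (P i) C × a i + 1 ≤ length C)
theorem1p3 zero    ()
theorem1p3 (suc s) _ N P _ patterns a 1≤a n prod<n = part-a , part-b
  where
  indexed : (c : Code s) → ∃ λ i → P i ≡ patternWord c
  indexed c = Equivalence.to (patterns (patternWord c)) (patternWord-isPattern c , patternWord-collectable c)

  index : Code s → Fin N
  index c = proj₁ (indexed c)

  index-injective : ∀ {c d} → index c ≡ index d → c ≡ d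
  index-injective {c} {d} eq = patternWord-injective c d
    (trans (sym (proj₂ (indexed c))) (trans (cong P eq) (proj₂ (indexed d))))

  product<n : product (map (a ∘ index) (codes s)) < n
  product<n = begin-strict
    product (map (a ∘ index) (codes s))     ≡⟨ cong product (map-∘ (codes s)) ⟩
    product (map a (map index (codes s)))
      -- Distinct codes have distinct pattern words and hence distinct indices.
      ≤⟨ product-⊆ a 1≤a (Unique.map⁺ index-injective (codes-unique s)) (λ {i} _ → ∈-allFin i) ⟩
    product (map a (allFin N))              ≡⟨ prodFin≡product a ⟨
    prodFin a                               <⟨ n<1+n (prodFin a) ⟩
    suc (prodFin a)                         ≡⟨ +-comm 1 (prodFin a) ⟩
    prodFin a + 1                           ≤⟨ prod<n ⟩
    n                                       ∎
    where open ≤-Reasoning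

  isCliqueIn-index : ∀ (M : Matching (suc s) n) c {C} →
                     AllPairs (Realises c on vertex M) C → IsCliqueIn M (P (index c)) C
  isCliqueIn-index M c {C} RC = subst (λ w → IsCliqueIn M w C) (sym (proj₂ (indexed c))) (cliqueOf⇒isCliqueIn M RC)

  part-a : ∀ (M : Matching (suc s) n) →
           ∃ λ i → Σ (List (Fin n)) λ C → IsCliqueIn M (P i) C × a i < length C * 2 ^ maturity (P i)
  part-a M =
    let c , C , RC , lt = weighted-clique M (a ∘ index) product<n in
    index c , C , isCliqueIn-index M c RC ,
    subst (λ m → a (index c) < length C * 2 ^ m) (sym (trans (cong maturity (proj₂ (indexed c))) (maturity-patternWord c))) lt

  clean⇒coded : ∀ {M : Matching (suc s) n} → Clean M → ∀ {x y} → x ≢ y → Coded s (vertex M x) (vertex M y)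
  clean⇒coded {M} clean {x} {y} x≢y with _ , _ , collectable , forms ← clean x y x≢y =
    collectable⇒coded M collectable x≢y forms

  part-b : ∀ (M : Matching (suc s) n) → Clean M →
           ∃ λ i → Σ (List (Fin n)) λ C → IsCliqueIn M (P i) C × a i + 1 ≤ length C
  part-b M clean =
    let c , C , RC , lt = coded-clique M (clean⇒coded {M} clean) (a ∘ index) product<n in
    index c , C , isCliqueIn-index M c RC ,
    subst₂ _≤_ (+-comm 1 _) (*-identityʳ (length C)) lt
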